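{- Let $G$ be a Hamiltonian chordal graph that is $4$-fan-free and such that every induced subgraph of $G$ isomorphic to $K_5 - e$ (if there are any) has true twins, i.e., contains two distinct vertices that are true twins in $G$. Then $G$ is cycle extendable.
   Context: All graphs are finite, undirected, and simple. A graph is Hamiltonian if it has a cycle through all its vertices. A graph is chordal if it has no induced cycle of length at least $4$. The $4$-fan is the graph on $6$ vertices obtained from a path on $5$ vertices by adding one vertex adjacent to all vertices of the path. A graph is $4$-fan-free if it has no induced subgraph isomorphic to the $4$-fan. $K_5 - e$ is the graph obtained from the complete graph on $5$ vertices by deleting one edge. Two distinct vertices $u,v$ of $G$ are true twins (in $G$) if $N[u]=N[v]$, where $N[v]$ is the closed neighborhood of $v$ in $G$. A cycle $C$ in a graph is extendable if there exists a cycle $C'$ whose vertex set consists of all vertices of $C$ plus exactly one more vertex not in $C$. A graph is cycle extendable if all its non-Hamiltonian cycles are extendable. -}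

module Defs where

open import Data.Fin.Base using (Fin; zero; suc; toℕ)
open import Data.Fin.Properties using (_≟_)
open import Data.Nat.Base using (ℕ; zero; suc; _≤_)
import Data.Nat.Properties as ℕ
open import Data.Empty using (⊥)
open import Data.Product.Base using (Σ-syntax; ∃-syntax; _×_; _,_; swap)
open import Data.Sum.Base as Sum using (_⊎_)
open import Data.Unit.Base using (⊤; tt)
open import Function.Base using (_∘_)
open import Function.Definitions using (Injective)
open import Level using (0ℓ)
open import Relation.Binary.Core using (Rel)
open import Relation.Binary.Definitions using (Decidable; Symmetric; Irreflexive)
open import Relation.Binary.PropositionalEquality.Core using (_≡_; _≢_; refl; ≢-sym)
open import Relation.Nullary.Decidable.Core using (yes; no; ¬?; _×-dec_; _⊎-dec_)
open import Relation.Nullary.Negation.Core using (¬_)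
open import Relation.Unary using (Pred; _∉_; _∪_; ｛_｝; _≐_; Universal)

-- Finite simple graphs on the vertex set Fin n.  Adjacency is required to be
-- decidable, which is automatic classically.
record Graph (n : ℕ) : Set₁ where
  infix 4 _~_ _~?_
  field
    _~_      : Rel (Fin n) 0ℓ
    _~?_     : Decidable _~_
    ~-sym    : Symmetric _~_
    ~-irrefl : Irreflexive _≡_ _~_

private
  variable
    k n : ℕ

-- The simple graph whose edges are the pairs of distinct vertices related by R
-- in at least one direction.
fromRel : (R : Rel (Fin n) 0ℓ) → Decidable R → Graph n
fromRel R R? = record
  { _~_      = λ i j → i ≢ j × (R i j ⊎ R j i)
  ; _~?_     = λ i j → ¬? (i ≟ j) ×-dec (R? i j ⊎-dec R? j i)
  ; ~-sym    = λ (i≢j , r) → ≢-sym i≢j , Sum.swap r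
  ; ~-irrefl = λ i≡j (i≢j , _) → i≢j i≡j
  }

complete : ∀ n → Graph n
complete n = fromRel (λ _ _ → ⊤) (λ _ _ → yes tt)

path : ∀ n → Graph n
path n = fromRel (λ i j → suc (toℕ i) ≡ toℕ j) (λ i j → suc (toℕ i) ℕ.≟ toℕ j)

-- 0 ~ 1 ~ ⋯ ~ n-1 ~ 0.  This is a genuine cycle only for n ≥ 3, and it is only
-- used together with such a bound.
cycle : ∀ n → Graph n
cycle n = fromRel
  (λ i j → suc (toℕ i) ≡ toℕ j ⊎ (suc (toℕ i) ≡ n × toℕ j ≡ 0))
  (λ i j → (suc (toℕ i) ℕ.≟ toℕ j) ⊎-dec ((suc (toℕ i) ℕ.≟ n) ×-dec (toℕ j ℕ.≟ 0)))

-- Adds one new vertex (zero) adjacent to all vertices of G.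
cone : Graph n → Graph (suc n)
cone {n} G = record
  { _~_      = _~ᶜ_
  ; _~?_     = dec
  ; ~-sym    = λ {i} {j} → symm i j
  ; ~-irrefl = λ {i} {j} → irr i j
  }
  where
  open Graph G

  _~ᶜ_ : Rel (Fin (suc n)) 0ℓ
  zero  ~ᶜ zero  = ⊥
  zero  ~ᶜ suc _ = ⊤
  suc _ ~ᶜ zero  = ⊤
  suc i ~ᶜ suc j = i ~ j

  dec : Decidable _~ᶜ_
  dec zero    zero    = no λ ()
  dec zero    (suc _) = yes tt
  dec (suc _) zero    = yes tt
  dec (suc i) (suc j) = i ~? j

  symm : ∀ i j → i ~ᶜ j → j ~ᶜ i
  symm zero    (suc _) _ = tt
  symm (suc _) zero    _ = tt
  symm (suc _) (suc _) e = ~-sym e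

  irr : ∀ i j → i ≡ j → ¬ (i ~ᶜ j)
  irr zero    _ refl ()
  irr (suc _) _ refl e = ~-irrefl refl e

deleteEdge : Fin n → Fin n → Graph n → Graph n
deleteEdge u v G = record
  { _~_      = λ i j → i ~ j × ¬ (i ≡ u × j ≡ v ⊎ i ≡ v × j ≡ u)
  ; _~?_     = λ i j → (i ~? j) ×-dec
                 ¬? (((i ≟ u) ×-dec (j ≟ v)) ⊎-dec ((i ≟ v) ×-dec (j ≟ u)))
  ; ~-sym    = λ (e , ¬uv) → ~-sym e , ¬uv ∘ Sum.map swap swap ∘ Sum.swap
  ; ~-irrefl = λ i≡j (e , _) → ~-irrefl i≡j e
  }
  where open Graph G

4-fan : Graph 6
4-fan = cone (path 5)

K₅-e : Graph 5
K₅-e = deleteEdge zero (suc zero) (complete 5)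

-- A subgraph of G, not necessarily induced, with a chosen isomorphism from H.
record Copy (H : Graph k) (G : Graph n) : Set where
  field
    vertex    : Fin k → Fin n
    injective : Injective _≡_ _≡_ vertex
    preserves : ∀ {i j} → Graph._~_ H i j → Graph._~_ G (vertex i) (vertex j)

-- An induced subgraph of G with a chosen isomorphism from H.
record InducedCopy (H : Graph k) (G : Graph n) : Set where
  field
    copy : Copy H G
  open Copy copy public
  field
    reflects : ∀ {i j} → Graph._~_ G (vertex i) (vertex j) → Graph._~_ H i j

record Cycle (G : Graph n) : Set where
  field
    length   : ℕ
    3≤length : 3 ≤ length
    copy     : Copy (cycle length) G
  open Copy copy public

module _ (G : Graph n) where
  open Graph G

  V : Cycle G → Pred (Fin n) 0ℓ
  V C v = ∃[ i ] Cycle.vertex C i ≡ v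

  HamiltonianCycle : Cycle G → Set
  HamiltonianCycle C = Universal (V C)

  Hamiltonian : Set
  Hamiltonian = Σ[ C ∈ Cycle G ] HamiltonianCycle C

  Chordal : Set
  Chordal = ∀ k → 4 ≤ k → ¬ InducedCopy (cycle k) G

  4-FanFree : Set
  4-FanFree = ¬ InducedCopy 4-fan G

  N[_] : Fin n → Pred (Fin n) 0ℓ
  N[ v ] w = w ≡ v ⊎ v ~ w

  TrueTwins : Fin n → Fin n → Set
  TrueTwins u v = u ≢ v × N[ u ] ≐ N[ v ]

  -- The twins lie in the copy of H, but the neighbourhoods are taken in G.
  HasTrueTwins : {H : Graph k} → InducedCopy H G → Set
  HasTrueTwins S = ∃[ i ] ∃[ j ] TrueTwins (vertex i) (vertex j)
    where open InducedCopy S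

  Extendable : Cycle G → Set
  Extendable C = Σ[ C′ ∈ Cycle G ] ∃[ x ] x ∉ V C × V C′ ≐ (V C ∪ ｛ x ｝)

  CycleExtendable : Set
  CycleExtendable = ∀ C → ¬ HamiltonianCycle C → Extendable C

{-# OPTIONS --safe #-}
module Submission where

-- Let C be non-Hamiltonian and, among the cycles H with V(C) ⊊ V(H), take a
-- shortest one.  Let P be a segment of H that has its ends x, y on C and its inner
-- vertices off C.  By minimality of H no inner vertex of P has adjacent neighbours
-- on P (otherwise bypass it, or H itself extends C), so P is an induced path by
-- chordality.  If C is not extendable, no vertex off C sees two consecutive vertices
-- of C.  Let L be an arc of C from x to y, and d a vertex off C.  Chordality shows
-- that two successive neighbours of d along L are adjacent and have a common
-- neighbour not adjacent to d.  Using 4-fan-freeness and the twins condition, it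
-- follows that N(d) ∩ L is a clique.  If p, q, r are successive on P, p and q are
-- inner and N(q) ∩ L ⊆ N[r], then N(p) ∩ L ⊆ N[q]: otherwise p has successive
-- neighbours c, b on L of which just c is adjacent to q, and c is the centre of a
-- 4-fan.  By induction from the end y of P, where the clique property is the base
-- case, the second inner vertex (or y) is adjacent to x, although P is induced.

open import Defs
open import Data.Empty using (⊥; ⊥-elim)
open import Data.Fin.Base using (Fin; zero; suc; toℕ; fromℕ)
open import Data.Fin.Patterns using (0F; 1F; 2F; 3F; 4F)
open import Data.Fin.Properties as Fin using (toℕ-injective; toℕ-fromℕ)
open import Data.List.Base using (List; []; _∷_; _++_; _∷ʳ_; length; lookup; filter; tabulate;
  allFin)
open import Data.List.Membership.Propositional using (_∈_; _∉_; find)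
open import Data.List.Membership.Propositional.Properties
  using (∈-∃++; ∈-++⁺ˡ; ∈-++⁺ʳ; ∈-tabulate⁺; ∈-tabulate⁻; ∈-filter⁺; ∈-filter⁻; ∈-lookup; ∈-allFin;
         ∈-AllPairs₂)
open import Data.List.Properties using (++-assoc; ++-identityʳ)
open import Data.List.Relation.Binary.Permutation.Propositional
  using (_↭_; ↭-sym; ↭-trans; ↭-prep; ↭-reflexive; ↭⇒↭ₛ)
open import Data.List.Relation.Binary.Permutation.Propositional.Properties
  using (↭-length; ∈-resp-↭; ++-comm; shift)
import Data.List.Relation.Binary.Permutation.Setoid.Properties as Permutation
open import Data.List.Relation.Binary.Subset.Propositional using (_⊆_)
open import Data.List.Relation.Unary.All as All using (All; []; _∷_)
import Data.List.Relation.Unary.All.Properties as All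
open import Data.List.Relation.Unary.AllPairs as AllPairs using (AllPairs; []; _∷_)
open import Data.List.Relation.Unary.Any as Any using (Any; here; there)
open import Data.List.Relation.Unary.Any.Properties using (lookup-index)
import Data.List.Relation.Unary.First as First
import Data.List.Relation.Unary.First.Properties as First
open import Data.List.Relation.Unary.Linked as Linked using (Linked; []; [-]; _∷_)
open import Data.List.Relation.Unary.Unique.Propositional using (Unique)
import Data.List.Relation.Unary.Unique.Propositional.Properties as Unique
open import Data.Nat.Base using (ℕ; zero; suc; _+_; _≤_; _<_; z≤n; s≤s; s<s⁻¹)
open import Data.Nat.Induction using (<-wellFounded)
open import Data.Nat.Properties using (suc-injective; <-cmp; ≤-reflexive; 1+n≢n; m≤n⇒m≤1+n)
open import Data.Product.Base using (Σ-syntax; ∃-syntax; _×_; _,_; proj₁; proj₂)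
open import Data.Sum.Base as Sum using (_⊎_; inj₁; inj₂)
open import Function.Base using (_∘_; id; case_of_)
open import Induction.WellFounded using (Acc; acc)
open import Level using (0ℓ)
open import Relation.Binary.Definitions using (tri<; tri≈; tri>)
open import Relation.Binary.PropositionalEquality
  using (_≡_; _≢_; refl; sym; trans; cong; subst; ≢-sym; setoid)
open import Relation.Nullary.Decidable using (True; toWitness)
open import Relation.Nullary.Decidable.Core as Dec using (Dec; yes; no)
open import Relation.Nullary.Negation.Core using (¬_; contradiction)
open import Relation.Unary using (Pred)

-- Lists with related consecutive entries; the trailing `w` closes up cyclic lists.

module _ {A : Set} {R : A → A → Set} where
  private
    variable
      x y w : A
      xs ys : List A

  split : ∀ xs → Linked R (xs ++ y ∷ ys) → Linked R (xs ∷ʳ y) × Linked R (y ∷ ys)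
  split []           l       = [-] , l
  split (x ∷ [])     (r ∷ l) = r ∷ [-] , l
  split (x ∷ z ∷ xs) (r ∷ l) with l₁ , l₂ ← split (z ∷ xs) l = r ∷ l₁ , l₂

  join : ∀ xs → Linked R (xs ∷ʳ y) → Linked R (y ∷ ys) → Linked R (xs ++ y ∷ ys)
  join []           _        l′ = l′
  join (x ∷ [])     (r ∷ _)  l′ = r ∷ l′
  join (x ∷ z ∷ xs) (r ∷ l)  l′ = r ∷ join (z ∷ xs) l l′

  split-∷ʳ : ∀ xs → Linked R ((xs ++ y ∷ ys) ∷ʳ w) → Linked R (xs ∷ʳ y) × Linked R (y ∷ ys ∷ʳ w)
  split-∷ʳ {y} {ys} {w} xs = split xs ∘ subst (Linked R) (++-assoc xs (y ∷ ys) (w ∷ []))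

  join-∷ʳ : ∀ xs → Linked R (xs ∷ʳ y) → Linked R (y ∷ ys ∷ʳ w) → Linked R ((xs ++ y ∷ ys) ∷ʳ w)
  join-∷ʳ {y} {ys} {w} xs l l′ =
    subst (Linked R) (sym (++-assoc xs (y ∷ ys) (w ∷ []))) (join xs l l′)

  lookup-linked : Linked R (xs ∷ʳ w) → ∀ i j → suc (toℕ i) ≡ toℕ j →
                  R (lookup xs i) (lookup xs j)
  lookup-linked {xs = x ∷ y ∷ xs} (r ∷ l) 0F      1F      _  = r
  lookup-linked {xs = x ∷ xs@(_ ∷ _)} (_ ∷ l) (suc i) (suc j) eq =
    lookup-linked l i j (suc-injective eq)

  lookup-linked-last : Linked R (xs ∷ʳ w) → ∀ i → suc (toℕ i) ≡ length xs →
                       R (lookup xs i) w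
  lookup-linked-last {xs = x ∷ []}         (r ∷ _) 0F      _  = r
  lookup-linked-last {xs = x ∷ xs@(_ ∷ _)} (_ ∷ l) (suc i) eq =
    lookup-linked-last l i (suc-injective eq)

  tabulate-linked : ∀ {k} (f : Fin (suc k) → A) →
                    (∀ i j → suc (toℕ i) ≡ toℕ j → R (f i) (f j)) → R (f (fromℕ k)) w →
                    Linked R (tabulate f ∷ʳ w)
  tabulate-linked {k = zero}  f rs r = r ∷ [-]
  tabulate-linked {k = suc k} f rs r =
    rs 0F 1F refl ∷ tabulate-linked (f ∘ suc) (λ i j eq → rs _ _ (cong suc eq)) r

Unique-lookup : ∀ {A : Set} {xs : List A} → Unique xs → ∀ i j → lookup xs i ≡ lookup xs j → i ≡ j
Unique-lookup {xs = _ ∷ _} _ 0F 0F _ = refl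
Unique-lookup (x≢ ∷ _)  0F      (suc j) eq = contradiction eq (All.lookup x≢ (∈-lookup j))
Unique-lookup (x≢ ∷ _)  (suc i) 0F      eq = contradiction (sym eq) (All.lookup x≢ (∈-lookup i))
Unique-lookup (_ ∷ xs!) (suc i) (suc j) eq = cong suc (Unique-lookup xs! i j eq)

-- Serves to find an edge by which a larger cycle leaves the given one.
exit : ∀ {A : Set} {T : A → Set} {x z : A} {xs} → (∀ y → Dec (T y)) → T x → z ∈ xs → ¬ T z →
       ∃[ as ] ∃[ a ] ∃[ b ] ∃[ bs ] x ∷ xs ≡ as ++ a ∷ b ∷ bs × T a × ¬ T b
exit {x = x} {xs = y ∷ ys} T? tx z∈ ¬tz with T? y
... | no ¬ty = [] , x , y , ys , refl , tx , ¬ty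
exit {x = x} T? tx (here refl) ¬tz | yes ty = contradiction ty ¬tz
exit {x = x} T? tx (there z∈) ¬tz | yes ty
  with as , a , b , bs , eq , ta , ¬tb ← exit T? ty z∈ ¬tz =
  x ∷ as , a , b , bs , cong (x ∷_) eq , ta , ¬tb

AllPairs-++⁻ˡ : ∀ {A : Set} {R : A → A → Set} xs {ys} → AllPairs R (xs ++ ys) → AllPairs R xs
AllPairs-++⁻ˡ []       _        = []
AllPairs-++⁻ˡ (x ∷ xs) (r ∷ rs) = All.++⁻ˡ xs r ∷ AllPairs-++⁻ˡ xs rs

two-members : ∀ {A : Set} {x y : A} {xs} → x ∈ xs → y ∈ xs → x ≢ y → 2 ≤ length xs
two-members (here refl)         (here refl)         x≢y = contradiction refl x≢y
two-members {xs = _ ∷ _ ∷ _} _  _                   _   = s≤s (s≤s z≤n)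
two-members {xs = _ ∷ []}    (here refl) (there ()) _
two-members {xs = _ ∷ []}    (there ())  _          _

-- The order of `x` and `y` in the list is unknown, so the change may occur in either direction.
switch : ∀ {A : Set} {R : A → A → Set} {T : A → Set} {x y : A} {xs : List A} →
         (∀ z → Dec (T z)) → Linked R xs → x ∈ xs → y ∈ xs → T x → ¬ T y →
         ∃[ a ] ∃[ b ] a ∈ xs × b ∈ xs × (R a b ⊎ R b a) × T a × ¬ T b
switch T? [-] (here refl) (here refl) tx ¬ty = contradiction tx ¬ty
switch T? (r ∷ l) (here refl) (here refl) tx ¬ty = contradiction tx ¬ty
switch T? (_∷_ {y = z} r l) (here refl) (there y∈) tx ¬ty with T? z
... | no ¬tz = _ , _ , here refl , there (here refl) , inj₁ r , tx , ¬tz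
... | yes tz with a , b , a∈ , b∈ , rest ← switch T? l (here refl) y∈ tz ¬ty =
  a , b , there a∈ , there b∈ , rest
switch T? (_∷_ {y = z} r l) (there x∈) (here refl) tx ¬ty with T? z
... | yes tz = _ , _ , there (here refl) , here refl , inj₂ r , tz , ¬ty
... | no ¬tz with a , b , a∈ , b∈ , rest ← switch T? l x∈ (here refl) tx ¬tz =
  a , b , there a∈ , there b∈ , rest
switch T? (r ∷ l) (there x∈) (there y∈) tx ¬ty
  with a , b , a∈ , b∈ , rest ← switch T? l x∈ y∈ tx ¬ty =
  a , b , there a∈ , there b∈ , rest

-- Induced paths as lists of vertices, and the induced copies built from them.

module InducedPaths {n} (G : Graph n) where
  open Graph G

  private
    variable
      a b c d u v w x y z : Fin n
      us vs : List (Fin n)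
      S T : Pred (Fin n) 0ℓ

  ~⇒≢ : u ~ v → u ≢ v
  ~⇒≢ u~v u≡v = ~-irrefl u≡v u~v

  ~-≁⇒≢ : d ~ u → ¬ d ~ v → u ≢ v
  ~-≁⇒≢ d~u d≁v refl = d≁v d~u

  Apart : Fin n → Fin n → Set
  Apart u v = ¬ u ~ v × u ≢ v

  Apart-sym : Apart u v → Apart v u
  Apart-sym (u≁v , u≢v) = u≁v ∘ ~-sym , ≢-sym u≢v

  -- The indices are the first vertex, the remaining vertices and the last vertex.
  data InducedPath : Fin n → List (Fin n) → Fin n → Set where
    end  : InducedPath u [] u
    step : u ~ v → All (Apart u) vs → InducedPath v vs w → InducedPath u (v ∷ vs) w

  compare : InducedPath u vs w → ∀ i j → toℕ i < toℕ j →
            let i′ = lookup (u ∷ vs) i; j′ = lookup (u ∷ vs) j in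
            (i′ ~ j′ × suc (toℕ i) ≡ toℕ j) ⊎ Apart i′ j′
  compare (step e _ _)     0F      1F            _   = inj₁ (e , refl)
  compare (step _ far _)   0F      (suc (suc j)) _   = inj₂ (All.lookup far (∈-lookup j))
  compare (step _ _ p)     (suc i) (suc j)       i<j =
    Sum.map₁ (λ (e , eq) → e , cong suc eq) (compare p i j (s<s⁻¹ i<j))

  lookup-injective : InducedPath u vs w → ∀ i j →
                     lookup (u ∷ vs) i ≡ lookup (u ∷ vs) j → i ≡ j
  lookup-injective p i j eq with <-cmp (toℕ i) (toℕ j)
  ... | tri≈ _ i≡j _ = toℕ-injective i≡j
  ... | tri< i<j _ _ = contradiction eq (Sum.[ ~⇒≢ ∘ proj₁ , proj₂ ]′ (compare p i j i<j))
  ... | tri> _ _ j<i = contradiction (sym eq) (Sum.[ ~⇒≢ ∘ proj₁ , proj₂ ]′ (compare p j i j<i))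

  consecutive : InducedPath u vs w → ∀ i j → suc (toℕ i) ≡ toℕ j →
                lookup (u ∷ vs) i ~ lookup (u ∷ vs) j
  consecutive (step e _ _) 0F      1F            _  = e
  consecutive (step _ _ p) (suc i) (suc j)       eq = consecutive p i j (suc-injective eq)

  lookup-last : InducedPath u vs w → ∀ i → toℕ i ≡ length vs → lookup (u ∷ vs) i ≡ w
  lookup-last end          0F      _  = refl
  lookup-last (step _ _ p) (suc i) eq = lookup-last p i (suc-injective eq)

  index-last : InducedPath u vs w → ∀ i → lookup (u ∷ vs) i ≡ w → toℕ i ≡ length vs
  index-last {vs = vs} p i eq = trans (cong toℕ (lookup-injective p i (fromℕ (length vs))
    (trans eq (sym (lookup-last p _ (toℕ-fromℕ (length vs))))))) (toℕ-fromℕ (length vs))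

  pathCopy : InducedPath u vs w → InducedCopy (path (suc (length vs))) G
  pathCopy {u} {vs} p = record
    { copy = record
      { vertex    = lookup (u ∷ vs)
      ; injective = lookup-injective p _ _
      ; preserves = λ { (_ , inj₁ eq) → consecutive p _ _ eq
                      ; (_ , inj₂ eq) → ~-sym (consecutive p _ _ eq) }
      }
    ; reflects = λ {i} {j} → reflects i j
    }
    where
    reflects : ∀ i j → lookup (u ∷ vs) i ~ lookup (u ∷ vs) j →
               i ≢ j × (suc (toℕ i) ≡ toℕ j ⊎ suc (toℕ j) ≡ toℕ i)
    reflects i j e with <-cmp (toℕ i) (toℕ j)
    ... | tri≈ _ i≡j _ = contradiction (cong (lookup (u ∷ vs)) (toℕ-injective i≡j)) (~⇒≢ e)
    ... | tri< i<j i≢j _ = i≢j ∘ cong toℕ ,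
      Sum.[ inj₁ ∘ proj₂ , (λ (i≁j , _) → contradiction e i≁j) ]′ (compare p i j i<j)
    ... | tri> _ i≢j j<i = i≢j ∘ cong toℕ ,
      Sum.[ inj₂ ∘ proj₂ , (λ (j≁i , _) → contradiction (~-sym e) j≁i) ]′ (compare p j i j<i)

  coneCopy : ∀ {k} {H : Graph k} (S : InducedCopy H G) →
             (∀ i → c ~ InducedCopy.vertex S i) → InducedCopy (cone H) G
  coneCopy {c = c} {H = H} S c~S = record
    { copy = record
      { vertex    = vertex′
      ; injective = λ {i} {j} → inj i j
      ; preserves = λ {i} {j} → pres i j
      }
    ; reflects = λ {i} {j} → refls i j
    }
    where
    open InducedCopy S
    module K = Graph (cone H)
    vertex′ : Fin _ → Fin n
    vertex′ zero    = c
    vertex′ (suc i) = vertex i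
    inj : ∀ i j → vertex′ i ≡ vertex′ j → i ≡ j
    inj zero    zero    _  = refl
    inj zero    (suc j) eq = contradiction eq (~⇒≢ (c~S j))
    inj (suc i) zero    eq = contradiction (sym eq) (~⇒≢ (c~S i))
    inj (suc i) (suc j) eq = cong suc (injective eq)
    pres : ∀ i j → i K.~ j → vertex′ i ~ vertex′ j
    pres zero    (suc j) _ = c~S j
    pres (suc i) zero    _ = ~-sym (c~S i)
    pres (suc i) (suc j) e = preserves e
    refls : ∀ i j → vertex′ i ~ vertex′ j → i K.~ j
    refls zero    zero    e = ~-irrefl refl e
    refls zero    (suc j) _ = _
    refls (suc i) zero    _ = _
    refls (suc i) (suc j) e = reflects e

  -- The cycle closed by `z` is induced because `z` sees only the ends of the path.
  cycleCopy : InducedPath u vs w → z ~ u → z ~ w →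
              All (z ≢_) (u ∷ vs) → All (λ v → v ≡ w ⊎ ¬ z ~ v) vs →
              InducedCopy (cycle (suc (suc (length vs)))) G
  cycleCopy {u} {vs} {w} {z} p z~u z~w z∉ far = record
    { copy = record
      { vertex    = vertex
      ; injective = λ {i} {j} → inj i j
      ; preserves = λ {i} {j} → pres i j
      }
    ; reflects = λ {i} {j} → refls i j
    }
    where
    module P = InducedCopy (pathCopy p)
    module K = Graph (cycle (suc (suc (length vs))))
    vertex : Fin _ → Fin n
    vertex zero    = z
    vertex (suc i) = P.vertex i

    inj : ∀ i j → vertex i ≡ vertex j → i ≡ j
    inj zero    zero    _  = refl
    inj zero    (suc j) eq = contradiction eq (All.lookup z∉ (∈-lookup j))
    inj (suc i) zero    eq = contradiction (sym eq) (All.lookup z∉ (∈-lookup i))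
    inj (suc i) (suc j) eq = cong suc (P.injective eq)

    toEnd : ∀ i → z ~ P.vertex i → zero K.~ suc i
    toEnd zero    _ = (λ ()) , inj₁ (inj₁ refl)
    toEnd (suc i) e with All.lookup far (∈-lookup i)
    -- One unit accounts for `z` in front of the path, the other for the successor in the closing
    -- edge.
    ... | inj₁ eq  = (λ ()) , inj₂ (inj₂ (cong (2 +_) (index-last p (suc i) eq) , refl))
    ... | inj₂ z≁i = contradiction e z≁i

    fromEnd : ∀ i → zero K.~ suc i → z ~ P.vertex i
    fromEnd zero    _                          = z~u
    fromEnd (suc i) (_ , inj₂ (inj₂ (eq , _))) =
      subst (z ~_) (sym (lookup-last p (suc i) (suc-injective (suc-injective eq)))) z~w
    fromEnd (suc i) (_ , inj₁ (inj₁ ()))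
    fromEnd (suc i) (_ , inj₁ (inj₂ (_ , ())))
    fromEnd (suc i) (_ , inj₂ (inj₁ ()))

    pres : ∀ i j → i K.~ j → vertex i ~ vertex j
    pres zero    zero    (0≢0 , _) = contradiction refl 0≢0
    pres zero    (suc j) e = fromEnd j e
    pres (suc i) zero    e = ~-sym (fromEnd i (K.~-sym e))
    pres (suc i) (suc j) (i≢j , e) = P.preserves (i≢j ∘ cong suc , Sum.map next next e)
      where
      next : ∀ {i j : Fin (suc (length vs))} {P : Set} →
             suc (suc (toℕ i)) ≡ suc (toℕ j) ⊎ (P × suc (toℕ j) ≡ 0) → suc (toℕ i) ≡ toℕ j
      next (inj₁ eq) = suc-injective eq

    refls : ∀ i j → vertex i ~ vertex j → i K.~ j
    refls zero    zero    e = contradiction refl (~⇒≢ e)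
    refls zero    (suc j) e = toEnd j e
    refls (suc i) zero    e = K.~-sym (toEnd i (~-sym e))
    refls (suc i) (suc j) e with i≢j , e′ ← P.reflects e =
      i≢j ∘ Fin.suc-injective , Sum.map (inj₁ ∘ cong suc) (inj₁ ∘ cong suc) e′

  -- Walks within a set of vertices, and induced paths extracted from them.

  data Walk (S : Pred (Fin n) 0ℓ) : Fin n → Fin n → Set where
    ⟨_⟩     : S u → Walk S u u
    _∷⟨_⟩_ : S u → u ~ v → Walk S v w → Walk S u w

  Walk-map : (∀ {z} → S z → T z) → Walk S u w → Walk T u w
  Walk-map f ⟨ s ⟩          = ⟨ f s ⟩
  Walk-map f (s ∷⟨ e ⟩ W) = f s ∷⟨ e ⟩ Walk-map f W

  start : Walk S u w → S u
  start ⟨ s ⟩         = s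
  start (s ∷⟨ _ ⟩ _) = s

  _++⟨_⟩_ : Walk S u v → v ~ x → Walk S x w → Walk S u w
  ⟨ s ⟩         ++⟨ e ⟩ W′ = s ∷⟨ e ⟩ W′
  (s ∷⟨ f ⟩ W) ++⟨ e ⟩ W′ = s ∷⟨ f ⟩ (W ++⟨ e ⟩ W′)

  _++ʷ_ : Walk S u v → Walk S v w → Walk S u w
  ⟨ s ⟩         ++ʷ W′ = W′
  (s ∷⟨ f ⟩ W) ++ʷ W′ = s ∷⟨ f ⟩ (W ++ʷ W′)

  reverse : Walk S u w → Walk S w u
  reverse ⟨ s ⟩         = ⟨ s ⟩
  reverse (s ∷⟨ e ⟩ W) = reverse W ++⟨ ~-sym e ⟩ ⟨ s ⟩

  InducedPath⇒Walk : InducedPath u vs w → Walk (_∈ u ∷ vs) u w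
  InducedPath⇒Walk end          = ⟨ here refl ⟩
  InducedPath⇒Walk (step e _ p) = here refl ∷⟨ e ⟩ Walk-map there (InducedPath⇒Walk p)

  Linked⇒Walk : ∀ us → Linked _~_ (u ∷ us ∷ʳ w) → Walk (_∈ u ∷ us ∷ʳ w) u w
  Linked⇒Walk []       (e ∷ [-]) = here refl ∷⟨ e ⟩ ⟨ there (here refl) ⟩
  Linked⇒Walk (v ∷ us) (e ∷ l)   = here refl ∷⟨ e ⟩ Walk-map there (Linked⇒Walk us l)

  -- The shortened path leaves u for the last neighbour of u on the given path.
  shortcut : S u → InducedPath v vs w → All S (v ∷ vs) →
             (∃[ us ] InducedPath u us w × All S (u ∷ us)) ⊎ All (Apart u) (v ∷ vs)
  shortcut {S = S} {u = u} {w = w} su = go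
    where
    Result : List (Fin n) → Set
    Result vs = (∃[ us ] InducedPath u us w × All S (u ∷ us)) ⊎ All (Apart u) vs

    here? : InducedPath v vs w → All S (v ∷ vs) → All (Apart u) vs → Result (v ∷ vs)
    here? {v = v} p sp far with u Fin.≟ v | u ~? v
    ... | yes refl | _       = inj₁ (_ , p , sp)
    ... | no _     | yes u~v = inj₁ (_ , step u~v far p , su ∷ sp)
    ... | no u≢v   | no u≁v  = inj₂ ((u≁v , u≢v) ∷ far)

    go : InducedPath v vs w → All S (v ∷ vs) → Result (v ∷ vs)
    go end            sp        = here? end sp []
    go p@(step _ _ q) (sv ∷ sp) = Sum.[ inj₁ , here? p (sv ∷ sp) ]′ (go q sp)

  -- Induction along the walk, with `shortcut` at each new first vertex; its second outcome is
  -- excluded since `u` sees the next vertex.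
  extract : Walk S u w → ∃[ vs ] InducedPath u vs w × All S (u ∷ vs)
  extract ⟨ s ⟩         = [] , end , s ∷ []
  extract (s ∷⟨ e ⟩ W) with vs , p , sp ← extract W with shortcut s p sp
  ... | inj₁ r                = r
  ... | inj₂ ((u≁v , _) ∷ _) = contradiction e u≁v

  -- Consequences of chordality.

  module Chordality (chordal : Chordal G) where

    -- The path is cut at the first neighbour of `z`; `S` carries along what is known about the
    -- vertices after `u`.
    trim : InducedPath u vs w → z ~ w → All S vs →
           ∃[ us ] ∃[ x ] InducedPath u us x × z ~ x ×
             All (λ v → v ≡ x ⊎ ¬ z ~ v) (u ∷ us) × All S us
    trim end z~w [] = [] , _ , end , z~w , inj₁ refl ∷ [] , []
    trim {u = u} {z = z} (step e far p) z~w (s ∷ ss) with z ~? u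
    ... | yes z~u = [] , _ , end , z~u , inj₁ refl ∷ [] , []
    ... | no z≁u
      with us , x , q , z~x , ends , both ← trim p z~w (All.zip (far , ss))
      = _ , x , step e (All.map proj₁ both) q , z~x , inj₂ z≁u ∷ ends , s ∷ All.map proj₂ both

    -- If `v` were the first vertex missed by `z`, the path from the vertex before `v` to the next
    -- neighbour of `z` would close up with `z` to an induced cycle of length at least 4.
    fan : InducedPath u vs w → z ~ u → z ~ w → All (z ≢_) (u ∷ vs) → All (z ~_) vs
    fan end _ _ _ = []
    fan {z = z} (step {v = v} e far p) z~u z~w (z≢u ∷ z≢v ∷ z∉) with z ~? v
    ... | yes z~v = z~v ∷ fan p z~v z~w (z≢v ∷ z∉)
    ... | no z≁v with trim p z~w (All.zip (far , z∉))
    ... | _ , _ , end , z~v , _ = contradiction z~v z≁v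
    ... | _ , _ , q@(step _ _ _) , z~x , ends , both = ⊥-elim (chordal _ (s≤s (s≤s (s≤s (s≤s z≤n))))
      (cycleCopy (step e (All.map proj₁ both) q) z~u z~x
        (z≢u ∷ z≢v ∷ All.map proj₂ both) ends))

    -- An induced path from `c` to `w` through `W` has both ends adjacent to `d`, so by `fan` its
    -- second vertex is the apex.
    apex : c ~ d → u ~ c → w ~ d → Walk S u w → (∀ {z} → S z → z ≢ c × z ≢ d) →
           ∃[ z ] S z × z ~ c × z ~ d
    apex {c = c} {d = d} {S = S} c~d u~c w~d W avoids
      with extract (inj₁ refl ∷⟨ ~-sym u~c ⟩ Walk-map {T = λ z → z ≡ c ⊎ S z} inj₂ W)
    ... | _ , end , _ = contradiction refl (proj₁ (avoids (start (reverse W))))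
    ... | _ , step c~z _ _ , _ ∷ inj₁ refl ∷ _ = contradiction refl (~⇒≢ c~z)
    ... | _ , p@(step {v = z} c~z _ _) , ss@(_ ∷ inj₂ sz ∷ _) =
      z , sz , ~-sym c~z , ~-sym (All.head (fan p (~-sym c~d) (~-sym w~d) (All.map d≢ ss)))
      where
      d≢ : ∀ {z} → z ≡ c ⊎ S z → d ≢ z
      d≢ (inj₁ refl) = ≢-sym (~⇒≢ c~d)
      d≢ (inj₂ s)    = ≢-sym (proj₂ (avoids s))

    -- Otherwise `u`, `x`, `y`, `z` would form an induced 4-cycle.
    middle : x ~ y → y ~ z → Apart x z → u ~ x → u ~ z → u ≢ y → u ~ y
    middle x~y y~z x≁z u~x u~z u≢y =
      All.head (fan (step x~y (x≁z ∷ []) (step y~z [] end)) u~x u~z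
        (~⇒≢ u~x ∷ u≢y ∷ ~⇒≢ u~z ∷ []))

    -- Meant for successive neighbours `x`, `y` of `d` along a list.
    Gap : Fin n → Fin n → Fin n → Set
    Gap d x y = x ~ y × ∃[ u ] Apart d u × u ~ x × u ~ y

    -- An induced path from `x` to `y` through `W` is a single edge, for `fan` would make `d`
    -- adjacent to its inner vertices; `apex` then gives the triangle on that edge.
    gap : d ~ x → d ~ y → x ≢ y → x ~ u → Walk (Apart d) u w → w ~ y → Gap d x y
    gap {d = d} {x = x} {y = y} d~x d~y x≢y x~u W w~y = x~y , apex x~y (~-sym x~u) w~y W
      λ (d≁z , _) → ≢-sym (~-≁⇒≢ d~x d≁z) , ≢-sym (~-≁⇒≢ d~y d≁z)
      where
      Allowed : Pred (Fin n) 0ℓ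
      Allowed z = z ≡ x ⊎ z ≡ y ⊎ Apart d z

      d≢ : ∀ {z} → Allowed z → d ≢ z
      d≢ (inj₁ refl)               = ~⇒≢ d~x
      d≢ (inj₂ (inj₁ refl))        = ~⇒≢ d~y
      d≢ (inj₂ (inj₂ (_ , d≢z))) = d≢z

      x~y : x ~ y
      x~y with extract {S = Allowed} (inj₁ refl ∷⟨ x~u ⟩
                 (Walk-map (inj₂ ∘ inj₂) W ++⟨ w~y ⟩ ⟨ inj₂ (inj₁ refl) ⟩))
      ... | _ , end , _ = contradiction refl x≢y
      ... | _ , p@(step x~v _ _) , ss@(_ ∷ sv ∷ _) with sv
      ...   | inj₁ refl               = contradiction refl (~⇒≢ x~v)
      ...   | inj₂ (inj₁ refl)        = x~v
      ...   | inj₂ (inj₂ (d≁v , _)) =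
        contradiction (All.head (fan p d~x d~y (All.map d≢ ss))) d≁v

    Gap-sym : Gap d x y ⊎ Gap d y x → Gap d x y
    Gap-sym (inj₁ g)                            = g
    Gap-sym (inj₂ (y~x , u , d∥u , u~y , u~x)) = ~-sym y~x , u , d∥u , u~x , u~y

    -- Holds for an edge of a cycle when `d` cannot be inserted between its ends.
    Skipping : Fin n → Fin n → Fin n → Set
    Skipping d x y = x ~ y × ¬ (d ~ x × d ~ y)

    near : Fin n → List (Fin n) → List (Fin n)
    near d = filter (d ~?_)

    module _ {d : Fin n} where
      -- `gaps-after` has just met the neighbour `x` of `d`; `gaps-across` keeps in `W` the
      -- non-neighbours met since `x`. By `Skipping`, there is at least one before the next
      -- neighbour.
      gaps-after : d ~ x → d ∉ vs → Unique (x ∷ vs) → Linked (Skipping d) (x ∷ vs) →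
                   Linked (Gap d) (x ∷ near d vs)
      gaps-across : d ~ x → x ~ u → Walk (Apart d) u w →
                    d ∉ vs → All (x ≢_) vs → Unique vs → Linked (Skipping d) (w ∷ vs) →
                    Linked (Gap d) (x ∷ near d vs)

      gaps-after {vs = []} _ _ _ _ = [-]
      gaps-after {vs = y ∷ _} d~x d∉ ((_ ∷ x≢) ∷ _ ∷ vs!) ((x~y , ¬both) ∷ l) with d ~? y
      ... | yes d~y = contradiction (d~x , d~y) ¬both
      ... | no d≁y  =
        gaps-across d~x x~y ⟨ d≁y , d∉ ∘ here ⟩ (d∉ ∘ there) x≢ vs! l

      gaps-across {vs = []} _ _ _ _ _ _ _ = [-]
      gaps-across {vs = y ∷ _} d~x x~u W d∉ (x≢y ∷ x≢) (y≢ ∷ vs!) ((w~y , _) ∷ l) with d ~? y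
      ... | yes d~y = gap d~x d~y x≢y x~u W w~y ∷ gaps-after d~y (d∉ ∘ there) (y≢ ∷ vs!) l
      ... | no d≁y  =
        gaps-across d~x x~u (W ++⟨ w~y ⟩ ⟨ d≁y , d∉ ∘ here ⟩) (d∉ ∘ there) x≢ vs! l

      gaps : d ∉ vs → Unique vs → Linked (Skipping d) vs → Linked (Gap d) (near d vs)
      gaps {vs = []} _ _ _ = []
      gaps {vs = x ∷ _} d∉ (x≢ ∷ vs!) l with d ~? x
      ... | yes d~x = gaps-after d~x (d∉ ∘ there) (x≢ ∷ vs!) l
      ... | no d≁x  = gaps (d∉ ∘ there) vs! (Linked.tail l)

    -- The path is `u`, `x`, `d`, `y`, `w` and the centre is `c`. By chordality, any chord of the
    -- path not excluded by hypothesis would make `d` adjacent to `u` or `w`.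
    no-4-fan : 4-FanFree G → x ~ d → d ~ y → Apart x y →
               u ~ x → Apart d u → w ~ y → Apart d w →
               c ~ u → c ~ x → c ~ d → c ~ y → c ~ w → ⊥
    no-4-fan {x = x} {d = d} {y = y} {u = u} {w = w} fanFree
             x~d d~y x∥y u~x d∥u w~y d∥w c~u c~x c~d c~y c~w =
      fanFree (coneCopy (pathCopy fivePath) λ
        { 0F → c~u ; 1F → c~x ; 2F → c~d ; 3F → c~y ; 4F → c~w })
      where
      u∥d = Apart-sym d∥u

      u∥y : Apart u y
      u∥y = (λ u~y → proj₁ u∥d (middle x~d d~y x∥y u~x u~y (proj₂ u∥d))) ,
            λ { refl → proj₁ d∥u d~y }

      x∥w : Apart x w
      x∥w = (λ x~w → proj₁ d∥w (~-sym (middle x~d d~y x∥y (~-sym x~w) w~y (≢-sym (proj₂ d∥w))))) ,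
            λ { refl → proj₁ d∥w (~-sym x~d) }

      u∥w : Apart u w
      u∥w = (λ u~w → proj₁ u∥d (All.head (fan
              (step x~d (x∥y ∷ x∥w ∷ []) (step d~y (d∥w ∷ []) (step (~-sym w~y) [] end)))
              u~x u~w (~⇒≢ u~x ∷ proj₂ u∥d ∷ proj₂ u∥y ∷ ~⇒≢ u~w ∷ [])))) ,
            λ { refl → proj₁ x∥w (~-sym u~x) }

      fivePath : InducedPath u (x ∷ d ∷ y ∷ w ∷ []) w
      fivePath =
        step u~x (u∥d ∷ u∥y ∷ u∥w ∷ []) (
        step x~d (x∥y ∷ x∥w ∷ []) (
        step d~y (d∥w ∷ []) (
        step (~-sym w~y) [] end)))

  -- True twins in an induced `K₅-e`.

  TrueTwins-sym : TrueTwins G u v → TrueTwins G v u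
  TrueTwins-sym (u≢v , ⊆ , ⊇) = ≢-sym u≢v , ⊇ , ⊆

  separated : Apart u z → v ~ z → ¬ TrueTwins G u v
  separated (u≁z , u≢z) v~z (_ , _ , ⊇) with ⊇ (inj₂ v~z)
  ... | inj₁ refl = u≢z refl
  ... | inj₂ u~z  = u≁z u~z

  allPairs : ∀ {k} {R : Fin k → Fin k → Set} → AllPairs R (allFin k) →
             ∀ i j → i ≡ j ⊎ R i j ⊎ R j i
  allPairs rs i j = ∈-AllPairs₂ rs (∈-allFin i) (∈-allFin j)

  -- By symmetry it suffices to check each unordered pair once.
  inducedCopy : ∀ {k} {H : Graph k} (vertex : Fin k → Fin n) →
                AllPairs (λ i j → Graph._~_ H i j × vertex i ~ vertex j ⊎
                                  ¬ Graph._~_ H i j × Apart (vertex i) (vertex j)) (allFin k) →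
                InducedCopy H G
  inducedCopy {H = H} vertex agree = record
    { copy = record
      { vertex    = vertex
      ; injective = λ {i} {j} eq → case allPairs agree i j of λ
          { (inj₁ i≡j)                     → i≡j
          ; (inj₂ (inj₁ (inj₁ (_ , e)))) → contradiction eq (~⇒≢ e)
          ; (inj₂ (inj₁ (inj₂ (_ , a)))) → contradiction eq (proj₂ a)
          ; (inj₂ (inj₂ (inj₁ (_ , e)))) → contradiction (sym eq) (~⇒≢ e)
          ; (inj₂ (inj₂ (inj₂ (_ , a)))) → contradiction (sym eq) (proj₂ a)
          }
      ; preserves = λ {i} {j} e → case allPairs agree i j of λ
          { (inj₁ i≡j)                        → contradiction e (K.~-irrefl i≡j)
          ; (inj₂ (inj₁ (inj₁ (_ , e′))))  → e′
          ; (inj₂ (inj₁ (inj₂ (¬e , _))))  → contradiction e ¬e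
          ; (inj₂ (inj₂ (inj₁ (_ , e′))))  → ~-sym e′
          ; (inj₂ (inj₂ (inj₂ (¬e , _))))  → contradiction (K.~-sym e) ¬e
          }
      }
    ; reflects = λ {i} {j} e → case allPairs agree i j of λ
        { (inj₁ i≡j)                        → contradiction (cong vertex i≡j) (~⇒≢ e)
        ; (inj₂ (inj₁ (inj₁ (e′ , _))))  → e′
        ; (inj₂ (inj₁ (inj₂ (_ , a))))    → contradiction e (proj₁ a)
        ; (inj₂ (inj₂ (inj₁ (e′ , _))))  → K.~-sym e′
        ; (inj₂ (inj₂ (inj₂ (_ , a))))    → contradiction (~-sym e) (proj₁ a)
        }
    }
    where module K = Graph H

  module Twins (twins : ∀ (S : InducedCopy K₅-e G) → HasTrueTwins G S) where

    -- In the copy formed by `x`, `y`, `d`, `a`, `b` only `a` and `b` can be twins: that `x` misses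
    -- `y` rules out every pair containing one of these, `u` rules out `d` with `a`, and `w` rules
    -- out `d` with `b`.
    twins-cover : Apart x y → a ~ b → d ~ a → d ~ b →
                  a ~ x → a ~ y → b ~ x → b ~ y → d ~ x → d ~ y →
                  Apart d u → u ~ a → Apart d w → w ~ b →
                  z ~ b → z ≢ a → z ~ a
    twins-cover {x} {y} {a} {b} {d} {u} {w} {z} x∥y a~b d~a d~b a~x a~y b~x b~y d~x d~y
                d∥u u~a d∥w w~b z~b z≢a = conclude (twins copy)
      where
      vertex : Fin 5 → Fin n
      vertex = lookup (x ∷ y ∷ d ∷ a ∷ b ∷ [])

      edge : ∀ i j → {_ : True (Graph._~?_ K₅-e i j)} → vertex i ~ vertex j →
             Graph._~_ K₅-e i j × vertex i ~ vertex j ⊎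
             ¬ Graph._~_ K₅-e i j × Apart (vertex i) (vertex j)
      edge _ _ {k} e = inj₁ (toWitness k , e)

      copy : InducedCopy K₅-e G
      copy = inducedCopy vertex (
        (inj₂ ((λ (_ , ¬01) → ¬01 (inj₁ (refl , refl))) , x∥y)
               ∷ edge 0F 2F (~-sym d~x) ∷ edge 0F 3F (~-sym a~x) ∷ edge 0F 4F (~-sym b~x) ∷ []) ∷
        (edge 1F 2F (~-sym d~y) ∷ edge 1F 3F (~-sym a~y) ∷ edge 1F 4F (~-sym b~y) ∷ []) ∷
        (edge 2F 3F d~a ∷ edge 2F 4F d~b ∷ []) ∷
        (edge 3F 4F a~b ∷ []) ∷ [] ∷ [])

      conclusion : AllPairs (λ i j → TrueTwins G (vertex i) (vertex j) → z ~ a) (allFin 5)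
      conclusion =
        ((λ (_ , _ , ⊇) → case ⊇ (inj₁ refl) of λ
            { (inj₁ y≡x) → contradiction (sym y≡x) (proj₂ x∥y)
            ; (inj₂ x~y) → contradiction x~y (proj₁ x∥y) })
          ∷ apart x∥y d~y ∷ apart x∥y a~y ∷ apart x∥y b~y ∷ []) ∷
        (apart y∥x d~x ∷ apart y∥x a~x ∷ apart y∥x b~x ∷ []) ∷
        (apart d∥u (~-sym u~a) ∷ apart d∥w (~-sym w~b) ∷ []) ∷
        ((λ (_ , _ , ⊇) → case ⊇ (inj₂ (~-sym z~b)) of λ
            { (inj₁ z≡a) → contradiction z≡a z≢a
            ; (inj₂ a~z) → ~-sym a~z })
          ∷ []) ∷ [] ∷ []
        where
        y∥x = Apart-sym x∥y
        apart : ∀ {u v z′} → Apart u z′ → v ~ z′ → TrueTwins G u v → z ~ a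
        apart u∥z v~z = ⊥-elim ∘ separated u∥z v~z

      conclude : HasTrueTwins G copy → z ~ a
      conclude (i , j , ij) with allPairs conclusion i j
      ... | inj₁ refl     = contradiction refl (proj₁ ij)
      ... | inj₂ (inj₁ f) = f ij
      ... | inj₂ (inj₂ f) = f (TrueTwins-sym ij)

-- Neighbours on an arc of vertices that cannot be inserted into it.

module OffCycle {n} (G : Graph n) (chordal : Chordal G) (fanFree : 4-FanFree G)
            (twins : ∀ (S : InducedCopy K₅-e G) → HasTrueTwins G S) where
  open Graph G
  open InducedPaths G
  open Chordality chordal
  open Twins twins

  private
    variable
      a b d p q s x y : Fin n
      us vs : List (Fin n)

  -- Induction from the back of the list: `x` sees `a` by the first gap, and `sweep` carries
  -- adjacency to `x` along the rest.
  clique : All (d ~_) vs → Linked (Gap d) vs → Unique vs → AllPairs _~_ vs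
  clique [] _ _ = []
  clique (_ ∷ []) _ _ = [] ∷ []
  clique {d = d} {vs = x ∷ a ∷ vs} (d~x ∷ d~a ∷ d~vs) ((x~a , u , d∥u , u~x , u~a) ∷ gs) (x≢ ∷ vs!)
    with rest@(a~vs ∷ _) ← clique (d~a ∷ d~vs) gs vs! =
    (x~a ∷ sweep (inj₁ refl) x~a d~a d~vs gs (All.tail x≢) a~vs) ∷ rest
    where
    -- If x misses some y after b in the list, then a and b, both common neighbours
    -- of x, d and y, are equal or twins, so a sees what fills the gap between b and y.
    sweep : b ≡ a ⊎ a ~ b → x ~ b → d ~ b → All (d ~_) us → Linked (Gap d) (b ∷ us) →
            All (x ≢_) us → All (a ~_) us → All (x ~_) us
    sweep _ _ _ [] _ _ _ = []
    sweep {b = b} {us = y ∷ _} a≈b x~b d~b (d~y ∷ d~us) ((b~y , w , d∥w , w~b , w~y) ∷ gs)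
          (x≢y ∷ x≢us) (a~y ∷ a~us) with x ~? y
    ... | yes x~y = x~y ∷ sweep (inj₂ a~y) x~y d~y d~us gs x≢us a~us
    -- The 4-fan has centre `a` and path `u`, `x`, `d`, `y`, `w`.
    ... | no x≁y  = ⊥-elim (no-4-fan fanFree (~-sym d~x) d~y x∥y u~x d∥u w~y d∥w
                      (~-sym u~a) (~-sym x~a) (~-sym d~a) a~y (~-sym (w~a a≈b)))
      where
      x∥y : Apart x y
      x∥y = x≁y , x≢y

      w~a : b ≡ a ⊎ a ~ b → w ~ a
      w~a (inj₁ refl) = w~b
      w~a (inj₂ a~b)  = twins-cover x∥y a~b d~a d~b (~-sym x~a) a~y (~-sym x~b) b~y d~x d~y
        d∥u u~a d∥w w~b w~b (≢-sym (~-≁⇒≢ d~a (proj₁ d∥w)))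

  -- Induced paths that join the ends of an arc outside it.

  module Arc {x y} {L : List (Fin n)} (L! : Unique L) (y∈L : y ∈ L) (arc : Walk (_∈ L) x y) where

    x∈L : x ∈ L
    x∈L = start arc

    Outside : Pred (Fin n) 0ℓ
    Outside d = d ∉ L × Linked (Skipping d) L

    gaps-near : Outside d → Linked (Gap d) (near d L)
    gaps-near (d∉ , l) = gaps d∉ L! l

    near-clique : Outside d → a ∈ L → d ~ a → b ∈ L → d ~ b → a ≡ b ⊎ a ~ b
    near-clique {d = d} o a∈ d~a b∈ d~b = Sum.map₂ Sum.[ id , ~-sym ]′ (∈-AllPairs₂
      (clique (All.all-filter (d ~?_) L) (gaps-near o) (Unique.filter⁺ (d ~?_) L!))
      (∈-filter⁺ (d ~?_) a∈ d~a) (∈-filter⁺ (d ~?_) b∈ d~b))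

    -- The walk W from s back to x, the arc, and the rest of the path close up to a
    -- cycle through the edge p q; the apex of a triangle on that edge lies on L,
    -- because the other vertices of the cycle do not see both p and q.
    dominates : Outside p → InducedPath p (q ∷ vs) y → All (λ z → z ≡ y ⊎ Outside z) (q ∷ vs) →
                s ~ p → Walk (λ z → z ≢ p × All (Apart z) (q ∷ vs)) s x →
                a ∈ L → p ~ a → q ≡ a ⊎ q ~ a
    -- The last inner vertex sees `y`, which lies on `L`, so the clique property applies to `y` and
    -- `a`.
    dominates o (step p~y [] end) _ _ _ a∈ p~a = near-clique o y∈L p~y a∈ p~a
    dominates _ (step _ _ path@(step _ _ _)) (inj₁ q≡y ∷ _) _ _ _ _
      with () ← index-last path 0F q≡y
    dominates {p = p} {q = q} {s = s} {a = a} o@(p∉L , _)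
              (step p~q p∥ path@(step {v = r} q~r q∥ rest)) (inj₂ o′@(q∉L , _) ∷ os) s~p W a∈ p~a
      with q ~? a
    ... | yes q~a = inj₂ q~a
    ... | no q≁a  = ⊥-elim absurd
      where
      -- The induction hypothesis for the edge from `q` to `r`; `p` takes the place of `s` and is
      -- put in front of `W`.
      dominates-next : ∀ {a} → a ∈ L → q ~ a → r ≡ a ⊎ r ~ a
      dominates-next = dominates o′ path os p~q
        ((~⇒≢ p~q , p∥) ∷⟨ ~-sym s~p ⟩ Walk-map (λ { (_ , (_ , z≢q) ∷ z∥) → z≢q , z∥ }) W)

      Around : Pred (Fin n) 0ℓ
      Around z = (z ≢ p × z ≢ q) × (z ∈ L ⊎ ¬ (p ~ z × q ~ z))

      around : Walk Around s r
      around =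
        Walk-map (λ { (z≢p , (z≁q , z≢q) ∷ _) → (z≢p , z≢q) , inj₂ (z≁q ∘ ~-sym ∘ proj₂) }) W ++ʷ
        (Walk-map (λ z∈ → ((λ { refl → p∉L z∈ }) , (λ { refl → q∉L z∈ })) , inj₁ z∈) arc ++ʷ
        reverse (Walk-map (λ z∈ →
          (≢-sym (proj₂ (All.lookup p∥ z∈)) , ≢-sym (All.lookup (~⇒≢ q~r ∷ All.map proj₂ q∥) z∈)) ,
          inj₂ (proj₁ (All.lookup p∥ z∈) ∘ proj₁)) (InducedPath⇒Walk rest)))

      common : Σ[ m ∈ Fin n ] m ∈ L × p ~ m × q ~ m
      common with apex p~q s~p (~-sym q~r) around proj₁
      ... | m , (_ , inj₁ m∈) , m~p , m~q  = m , m∈ , ~-sym m~p , ~-sym m~q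
      ... | m , (_ , inj₂ ¬pq) , m~p , m~q = contradiction (~-sym m~p , ~-sym m~q) ¬pq

      absurd : ⊥
      absurd
        with m , m∈ , p~m , q~m ← common
        -- Among the neighbours of `p` on `L`, `q` sees `m` but not `a`, so adjacency to `q` changes
        -- at some successive pair.
        with c , b , c∈ , b∈ , g , q~c , q≁b ← switch (q ~?_) (gaps-near o)
               (∈-filter⁺ (p ~?_) m∈ p~m) (∈-filter⁺ (p ~?_) a∈ p~a) q~m q≁a
        with c∈L , p~c ← ∈-filter⁻ (p ~?_) {xs = L} c∈
        with b∈L , p~b ← ∈-filter⁻ (p ~?_) {xs = L} b∈
        with c~b , u , p∥u , u~c , u~b ← Gap-sym g
        with dominates-next c∈L q~c
      ... | inj₁ refl = proj₁ (All.head p∥) p~c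
      -- The 4-fan has centre `c` and path `u`, `b`, `p`, `q`, `r`.
      ... | inj₂ r~c  = no-4-fan fanFree (~-sym p~b) p~q (q≁b ∘ ~-sym , λ { refl → q∉L b∈L })
        u~b p∥u (~-sym q~r) (All.head p∥) (~-sym u~c) c~b (~-sym p~c) (~-sym q~c) (~-sym r~c)

    -- With `x` as both `s` and `a`, `dominates` makes `q` equal or adjacent to `x`, though the path
    -- is induced.
    no-detour : InducedPath x (p ∷ q ∷ vs) y → ¬ All (λ z → z ≡ y ⊎ Outside z) (p ∷ q ∷ vs)
    no-detour path@(step _ _ (step _ _ _)) (inj₁ p≡y ∷ _)
      with () ← index-last path 1F p≡y
    no-detour (step x~p (x∥q ∷ x∥) path) (inj₂ o ∷ os)
      with dominates o path os x~p ⟨ ~⇒≢ x~p , x∥q ∷ x∥ ⟩ x∈L (~-sym x~p)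
    ... | inj₁ q≡x = proj₂ x∥q (sym q≡x)
    ... | inj₂ q~x = proj₁ x∥q (~-sym q~x)

-- Cycles as lists: rotation, bypassing and insertion of vertices.

module Rings {n} (G : Graph n) where
  open Graph G
  open InducedPaths G
  open import Data.List.Membership.DecPropositional (Fin._≟_ {n}) using (_∈?_)

  private
    variable
      h u v w x y z : Fin n
      us vs xs ys : List (Fin n)

  Unique-resp-↭ : xs ↭ ys → Unique xs → Unique ys
  Unique-resp-↭ p = Permutation.Unique-resp-↭ (setoid (Fin n)) (↭⇒↭ₛ p)

  -- Repeating `h` at the end makes the closing edge an ordinary link.
  data Ring : List (Fin n) → Set where
    ring : ∀ {h t} → Unique (h ∷ t) → 2 ≤ length t → Linked _~_ (h ∷ t ∷ʳ h) → Ring (h ∷ t)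

  toCycle : Ring xs → Cycle G
  toCycle (ring {h} {t} xs! 2≤ l) = record
    { length   = suc (length t)
    ; 3≤length = s≤s 2≤
    ; copy     = record
      { vertex    = lookup (h ∷ t)
      ; injective = Unique-lookup xs! _ _
      ; preserves = λ { (_ , inj₁ e) → edge e ; (_ , inj₂ e) → ~-sym (edge e) }
      }
    }
    where
    edge : ∀ {i j} → suc (toℕ i) ≡ toℕ j ⊎ (suc (toℕ i) ≡ suc (length t) × toℕ j ≡ 0) →
           lookup (h ∷ t) i ~ lookup (h ∷ t) j
    edge (inj₁ eq)                = lookup-linked l _ _ eq
    edge {j = 0F} (inj₂ (eq , _)) = lookup-linked-last l _ eq

  ∈-toCycle : (r : Ring xs) → v ∈ xs → V G (toCycle r) v
  ∈-toCycle (ring _ _ _) v∈ = Any.index v∈ , sym (lookup-index v∈)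

  toCycle-∈ : (r : Ring xs) → V G (toCycle r) v → v ∈ xs
  toCycle-∈ (ring {h} {t} _ _ _) (i , refl) = ∈-lookup {xs = h ∷ t} i

  fromCycle : (C : Cycle G) → Ring (tabulate (Cycle.vertex C))
  fromCycle record { length = suc (suc (suc k)) ; 3≤length = s≤s (s≤s (s≤s z≤n)) ; copy = copy } =
    ring (Unique.tabulate⁺ injective) (s≤s (s≤s z≤n))
      (tabulate-linked vertex
        (λ i j eq → preserves ((λ { refl → 1+n≢n eq }) , inj₁ (inj₁ eq)))
        (preserves ((λ ()) , inj₁ (inj₂ (cong suc (toℕ-fromℕ _) , refl)))))
    where open Copy copy

  rotate : ∀ xs → Ring (xs ++ y ∷ ys) → Ring (y ∷ ys ++ xs)
  rotate {y = y} {ys = ys} [] r = subst Ring (sym (++-identityʳ (y ∷ ys))) r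
  rotate {y = y} {ys = ys} (h ∷ t) (ring xs! 2≤ l) =
    ring (Unique-resp-↭ perm xs!)
         (subst (2 ≤_) (suc-injective (↭-length perm)) 2≤)
         closed
    where
    perm : h ∷ t ++ y ∷ ys ↭ y ∷ ys ++ h ∷ t
    perm = ++-comm (h ∷ t) (y ∷ ys)

    closed : Linked _~_ (y ∷ (ys ++ h ∷ t) ∷ʳ y)
    closed with l₁ , l₂ ← split-∷ʳ (h ∷ t) l = join-∷ʳ (y ∷ ys) l₂ l₁

  rotate-to : Ring xs → y ∈ xs → ∃[ ys ] Ring (y ∷ ys) × xs ↭ y ∷ ys
  rotate-to r y∈ with as , bs , refl ← ∈-∃++ y∈ = _ , rotate as r , ++-comm as _

  module _ (chordal : Chordal G) where
    open Chordality chordal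

    prefix : ∀ {S : Pred (Fin n) 0ℓ} → InducedPath u (v ∷ vs) w → y ∈ v ∷ vs → All S vs →
             ∃[ us ] InducedPath u (v ∷ us) y × All S us
    prefix (step e _ _) (here refl) _ = [] , step e [] end , []
    prefix (step e (v∥ ∷ far) p@(step _ _ _)) (there y∈) (s ∷ ss)
      with us , q , both ← prefix p y∈ (All.zip (far , ss)) =
      _ , step e (v∥ ∷ All.map proj₁ both) q , s ∷ All.map proj₂ both

    -- On the path up to the later neighbour of `x`, `fan` makes `x` see the vertex after `u`, so
    -- `u` can be left out.
    bypass : InducedPath u vs w → Linked _~_ (u ∷ vs) → x ~ u → Any (x ~_) vs →
             All (x ≢_) (u ∷ vs) → Linked _~_ (x ∷ vs)
    bypass p@(step _ _ _) l x~u near (x≢u ∷ x≢v ∷ x≢) with y , y∈ , x~y ← find near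
      with _ , q , x≢′ ← prefix p y∈ x≢ =
      All.head (fan q x~u x~y (x≢u ∷ x≢v ∷ x≢′)) ∷ Linked.tail l

    -- If u sees a later vertex of the path than the next one, then chordality
    -- makes it see the second one, so that the next one can be bypassed.
    straighten : ∀ us → Linked _~_ (u ∷ us ∷ʳ v) → Unique (u ∷ us ∷ʳ v) →
                 InducedPath u (us ∷ʳ v) v ⊎
                 ∃[ xs ] ∃[ z ] ∃[ ys ] us ≡ xs ++ z ∷ ys × Linked _~_ (u ∷ (xs ++ ys) ∷ʳ v)
    straighten [] (u~v ∷ l) _ = inj₁ (step u~v [] end)
    straighten {u = u} {v = v} (x ∷ us) (u~x ∷ l) ((u≢x ∷ u≢) ∷ xs!) with straighten us l xs!
    ... | inj₂ (xs , z , ys , refl , l′) = inj₂ (x ∷ xs , z , ys , refl , u~x ∷ l′)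
    ... | inj₁ p with Any.any? (u ~?_) (us ∷ʳ v)
    ...   | no far = inj₁ (step u~x (All.zip (All.¬Any⇒All¬ _ far , u≢)) p)
    ...   | yes near = inj₂ ([] , x , us , refl , bypass p l u~x near (u≢x ∷ u≢))

    insert : ∀ z us → Linked _~_ (u ∷ us ∷ʳ v) → Linked (Skipping z) (u ∷ us ∷ʳ v) ⊎
             ∃[ xs ] ∃[ ys ] us ≡ xs ++ ys × Linked _~_ (u ∷ (xs ++ z ∷ ys) ∷ʳ v)
    insert {u} {v} z [] (u~v ∷ [-]) with z ~? u | z ~? v
    ... | yes z~u | yes z~v = inj₂ ([] , [] , refl , ~-sym z~u ∷ z~v ∷ [-])
    ... | no z≁u  | _       = inj₁ ((u~v , z≁u ∘ proj₁) ∷ [-])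
    ... | _       | no z≁v  = inj₁ ((u~v , z≁v ∘ proj₂) ∷ [-])
    insert {u} {v} z (x ∷ us) (u~x ∷ l) with insert z us l
    ... | inj₂ (xs , ys , refl , l′) = inj₂ (x ∷ xs , ys , refl , u~x ∷ l′)
    ... | inj₁ s with z ~? u | z ~? x
    ... | yes z~u | yes z~x = inj₂ ([] , x ∷ us , refl , ~-sym z~u ∷ z~x ∷ l)
    ... | no z≁u  | _       = inj₁ ((u~x , z≁u ∘ proj₁) ∷ s)
    ... | _       | no z≁x  = inj₁ ((u~x , z≁x ∘ proj₂) ∷ s)

-- Descent from a larger cycle to an extension of the given one.

shift-++ : ∀ {A : Set} (xs ys : List A) {z zs} → (xs ++ z ∷ ys) ++ zs ↭ z ∷ (xs ++ ys) ++ zs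
shift-++ xs ys {z} {zs} =
  ↭-trans (↭-reflexive (++-assoc xs (z ∷ ys) zs))
  (↭-trans (shift z xs (ys ++ zs))
  (↭-reflexive (cong (z ∷_) (sym (++-assoc xs ys zs)))))

module Extending {n} (G : Graph n) (chordal : Chordal G) (fanFree : 4-FanFree G)
            (twins : ∀ (S : InducedCopy K₅-e G) → HasTrueTwins G S)
            {cs : List (Fin n)} (C : Rings.Ring G cs) where
  open Graph G
  open InducedPaths G
  open Rings G
  open Chordality chordal
  open OffCycle G chordal fanFree twins
  open import Data.List.Membership.DecPropositional (Fin._≟_ {n}) using (_∈?_)

  private
    variable
      h x y z : Fin n
      l : List (Fin n)

  Extension : Set
  Extension = ∃[ l ] ∃[ x ] Ring l × x ∉ cs × l ⊆ x ∷ cs × x ∷ cs ⊆ l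

  ∈cs-∉cs⇒≢ : x ∈ cs → z ∉ cs → z ≢ x
  ∈cs-∉cs⇒≢ x∈ z∉ refl = z∉ x∈

  -- If no inner vertex of the path can be inserted into the cycle `cs`, all of them skip its edges,
  -- which `no-detour` excludes for the arc from `h` to `y`.
  detour : ∀ q qs → h ∈ cs → y ∈ cs → y ≢ h → All (_∉ cs) (q ∷ qs) →
           InducedPath h ((q ∷ qs) ∷ʳ y) y → Extension
  detour {h = h} {y = y} q qs h∈ y∈ y≢h qs∉ p
    with _ , ring t! 2≤ l , σ ← rotate-to C h∈
    with as , bs , refl ← ∈-∃++ (Any.tail y≢h (∈-resp-↭ σ y∈)) =
    Sum.[ ⊥-elim ∘ no-skips , proj₂ ∘ Any.satisfied ]′ (All.decide test (q ∷ qs))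
    where
    t = as ++ y ∷ bs

    -- The premise `z ∉ cs` is built in so that `test` covers every vertex, as `All.decide` demands.
    Skips : Pred (Fin n) 0ℓ
    Skips z = z ∉ cs → Linked (Skipping z) (h ∷ t ∷ʳ h)

    test : ∀ z → Skips z ⊎ Extension
    test z with z ∈? cs
    ... | yes z∈ = inj₁ (contradiction z∈)
    ... | no z∉ with insert chordal z t l
    ...   | inj₁ s = inj₁ λ _ → s
    ...   | inj₂ (xs , ys , eq , l′) = inj₂
      ( _ , z
      , ring (Unique-resp-↭ (↭-sym π) (All.¬Any⇒All¬ _ (z∉ ∘ ∈-resp-↭ (↭-sym σ)) ∷ t!))
             (subst (2 ≤_) (suc-injective (sym (↭-length π))) (m≤n⇒m≤1+n 2≤))
             l′
      , z∉
      , ∈-resp-↭ (↭-trans π (↭-prep z (↭-sym σ)))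
      , ∈-resp-↭ (↭-sym (↭-trans π (↭-prep z (↭-sym σ)))))
      where
      π : h ∷ xs ++ z ∷ ys ↭ z ∷ h ∷ t
      π = subst (λ t → h ∷ xs ++ z ∷ ys ↭ z ∷ h ∷ t) (sym eq) (shift z (h ∷ xs) ys)

    L : List (Fin n)
    L = h ∷ as ∷ʳ y

    L-prefix : h ∷ t ≡ L ++ bs
    L-prefix = sym (++-assoc (h ∷ as) (y ∷ []) bs)

    L-linked : ∀ {R : Fin n → Fin n → Set} → Linked R (h ∷ t ∷ʳ h) → Linked R L
    L-linked l = proj₁ (split-∷ʳ (h ∷ as) l)

    L⊆cs : L ⊆ cs
    L⊆cs {v} v∈ = ∈-resp-↭ (↭-sym σ) (subst (v ∈_) (sym L-prefix) (∈-++⁺ˡ v∈))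

    open Arc (AllPairs-++⁻ˡ L (subst Unique L-prefix t!)) (there (∈-++⁺ʳ as (here refl)))
             (Linked⇒Walk as (L-linked l))

    no-skips : ¬ All Skips (q ∷ qs)
    no-skips skips = no-detour′ qs p (All.∷ʳ⁺
      (All.map (λ (q∉ , s) → inj₂ (q∉ ∘ L⊆cs , L-linked (s q∉))) (All.zip (qs∉ , skips)))
      (inj₁ refl))
      where
      -- Splitting on `qs` exposes the second entry of the list, which `no-detour` expects.
      no-detour′ : ∀ qs → InducedPath h ((q ∷ qs) ∷ʳ y) y →
                   ¬ All (λ z → z ≡ y ⊎ Outside z) ((q ∷ qs) ∷ʳ y)
      no-detour′ []      = no-detour
      no-detour′ (_ ∷ _) = no-detour

  -- The induction hypothesis of `extend`.
  Descent : List (Fin n) → Set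
  Descent l = ∀ {l′ z} → length l′ < length l → Ring l′ → cs ⊆ l′ → z ∈ l′ → z ∉ cs → Extension

  -- Without `z` the cycle is shorter and still contains `cs`. If a vertex off `cs` remains, the
  -- descent continues; otherwise the given cycle is `cs` plus `z`.
  drop : ∀ {qs} xs z ys post → qs ≡ xs ++ z ∷ ys → let l = h ∷ qs ++ y ∷ post in
         Ring l → Linked _~_ (h ∷ (xs ++ ys) ∷ʳ y) → cs ⊆ l →
         h ∈ cs → y ∈ cs → z ∉ cs → Descent l → Extension
  drop {h = h} {y = y} xs z ys post refl r@(ring l! _ l-linked) bypassed cs⊆ h∈ y∈ z∉ descend
    with All.all? (_∈? cs) (h ∷ (xs ++ ys) ++ y ∷ post)
  ... | yes all = _ , z , r , z∉ ,
    (λ v∈ → case ∈-resp-↭ π v∈ of λ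
      { (here v≡z)  → here v≡z
      ; (there v∈′) → there (All.lookup all v∈′) }) ,
    λ { (here refl) → ∈-resp-↭ (↭-sym π) (here refl) ; (there v∈) → cs⊆ v∈ }
    where
    π = shift-++ (h ∷ xs) ys
  ... | no ¬all with w , w∈ , w∉ ← find (All.¬All⇒Any¬ (_∈? cs) _ ¬all) =
    descend (≤-reflexive (sym (↭-length π))) (ring l′! 2≤ l′-linked)
      (λ v∈ → Any.tail (≢-sym (∈cs-∉cs⇒≢ v∈ z∉)) (∈-resp-↭ π (cs⊆ v∈))) w∈ w∉
    where
    π = shift-++ (h ∷ xs) ys

    l′! : Unique (h ∷ (xs ++ ys) ++ y ∷ post)
    l′! = AllPairs.tail (Unique-resp-↭ π l!)

    2≤ : 2 ≤ length ((xs ++ ys) ++ y ∷ post)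
    -- The distinct vertices `w` and `y` both come after `h`.
    2≤ = two-members (Any.tail (∈cs-∉cs⇒≢ h∈ w∉) w∈) (∈-++⁺ʳ (xs ++ ys) (here refl))
           (∈cs-∉cs⇒≢ y∈ w∉)

    l′-linked : Linked _~_ (h ∷ ((xs ++ ys) ++ y ∷ post) ∷ʳ h)
    l′-linked = join-∷ʳ (h ∷ xs ++ ys) bypassed (proj₂ (split-∷ʳ (h ∷ xs ++ z ∷ ys) l-linked))

  -- An induced segment is a detour around `cs`; any other can be shortened.
  segment : ∀ q qs post → let l = h ∷ (q ∷ qs) ++ y ∷ post in
            Ring l → cs ⊆ l → h ∈ cs → y ∈ cs → All (_∉ cs) (q ∷ qs) → Descent l → Extension
  segment {h = h} {y = y} q qs post r@(ring l! _ l-linked) cs⊆ h∈ y∈ qs∉ descend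
    with straighten chordal (q ∷ qs)
           (proj₁ (split-∷ʳ (h ∷ q ∷ qs) l-linked))
           (AllPairs-++⁻ˡ (h ∷ (q ∷ qs) ∷ʳ y)
             (subst Unique (sym (++-assoc (h ∷ q ∷ qs) (y ∷ []) post)) l!))
  ... | inj₁ p = detour q qs h∈ y∈
    (≢-sym (All.lookup (AllPairs.head l!) (∈-++⁺ʳ (q ∷ qs) (here refl)))) qs∉ p
  ... | inj₂ (xs , z , ys , eq , bypassed) = drop xs z ys post eq r bypassed cs⊆ h∈ y∈
    (All.lookup qs∉ (subst (z ∈_) (sym eq) (∈-++⁺ʳ xs (here refl)))) descend

  nonempty : Ring l → ∃[ v ] v ∈ l
  nonempty (ring _ _ _) = _ , here refl

  another : h ∈ cs → ∃[ c ] c ∈ cs × c ≢ h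
  another h∈ with rotate-to C h∈
  ... | _ , ring {t = c ∷ _} ((h≢c ∷ _) ∷ _) _ _ , σ =
    c , ∈-resp-↭ (↭-sym σ) (there (here refl)) , ≢-sym h≢c

  -- The segment ends at the first vertex of `cs` in `rest`; without one, `h` would be the only
  -- vertex of `cs`.
  leave : ∀ b rest → Ring (h ∷ b ∷ rest) → cs ⊆ h ∷ b ∷ rest → h ∈ cs → b ∉ cs →
          Descent (h ∷ b ∷ rest) → Extension
  leave b rest r cs⊆ h∈ b∉ descend with First.first (λ v → Sum.swap (Dec.toSum (v ∈? cs))) rest
  ... | inj₂ rest∉ with c , c∈ , c≢h ← another h∈ =
    contradiction c∈ (All.lookup rest∉ (Any.tail (≢-sym (∈cs-∉cs⇒≢ c∈ b∉)) (Any.tail c≢h (cs⊆ c∈))))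
  ... | inj₁ f with First.toView f
  ...   | qs∉ First.++ y∈ ∷ post = segment b _ post r cs⊆ h∈ y∈ (b∉ ∷ qs∉) descend

  -- Well-founded induction on the length of the larger cycle replaces the choice of a shortest one.
  -- Rotations bring an edge leaving `cs` to the front.
  extend : Acc _<_ (length l) → Ring l → cs ⊆ l → z ∈ l → z ∉ cs → Extension
  extend {l = l} (acc rs) r cs⊆ z∈ z∉
    with c , c∈ ← nonempty C
    with t , r₁ , σ ← rotate-to r (cs⊆ c∈)
    with as , h , b , bs , eq , h∈ , b∉ ←
      exit (_∈? cs) c∈ (Any.tail (∈cs-∉cs⇒≢ c∈ z∉) (∈-resp-↭ σ z∈)) z∉ =
    leave b (bs ++ as) (rotate as (subst Ring eq r₁)) (∈-resp-↭ τ ∘ cs⊆) h∈ b∉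
      (λ shorter → extend (rs (subst (_ <_) (sym (↭-length τ)) shorter)))
    where
    τ : l ↭ h ∷ (b ∷ bs) ++ as
    τ = ↭-trans σ (↭-trans (↭-reflexive eq) (++-comm as (h ∷ b ∷ bs)))

theorem1p2 : ∀ {n : ℕ} (G : Graph n) →
    Hamiltonian G →
    Chordal G →
    4-FanFree G →
    (∀ (S : InducedCopy K₅-e G) → HasTrueTwins G S) →
    CycleExtendable G
theorem1p2 {n} G (H , spanning) chordal fanFree twins C ¬spanning =
  -- The Hamiltonian cycle contains all of `C` and a vertex off it, so the descent can start there.
  conclude (extend (<-wellFounded _) (fromCycle H) (λ {v} _ → all-in-H v) (all-in-H _)
    (proj₂ outsider))
  where
  open Rings G
  open Extending G chordal fanFree twins (fromCycle C)
  open import Data.List.Membership.DecPropositional (Fin._≟_ {n}) using (_∈?_)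

  ∈⇒V : ∀ (C : Cycle G) {v} → v ∈ tabulate (Cycle.vertex C) → V G C v
  ∈⇒V C v∈ with i , eq ← ∈-tabulate⁻ v∈ = i , sym eq

  V⇒∈ : ∀ (C : Cycle G) {v} → V G C v → v ∈ tabulate (Cycle.vertex C)
  V⇒∈ C (i , refl) = ∈-tabulate⁺ i

  all-in-H : ∀ v → v ∈ tabulate (Cycle.vertex H)
  all-in-H v = V⇒∈ H (spanning v)

  outsider : ∃[ z ] z ∉ tabulate (Cycle.vertex C)
  outsider = Fin.¬∀⟶∃¬ n (_∈ tabulate (Cycle.vertex C)) (_∈? tabulate (Cycle.vertex C))
    λ all → ¬spanning λ v → ∈⇒V C (all v)

  conclude : Extension → Extendable G C
  conclude (l , x , r , x∉ , l⊆ , ⊆l) =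
    toCycle r , x , (x∉ ∘ V⇒∈ C) ,
    (λ v∈ → case l⊆ (toCycle-∈ r v∈) of λ
      { (here refl) → inj₂ refl
      ; (there v∈C) → inj₁ (∈⇒V C v∈C) }) ,
    λ { (inj₁ v∈C) → ∈-toCycle r (⊆l (there (V⇒∈ C v∈C)))
      ; (inj₂ refl) → ∈-toCycle r (⊆l (here refl)) }
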